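{- Let $(X,\mathcal{R})$ be a set system. Assume that for any weight assignment $w\colon X\to\mathbb{R}$ we can solve range sampling queries on the input $(X,\mathcal{R})$ with weights $w$ using $S(|X|)$ space and $Q(|X|)$ query time, where a query returns only one sample. Then, given the set $X$ and a weight function $w'\colon X\to\mathbb{R}$, we can store $X$ in a data structure of size $S(|X|)$ such that, given a query $R\in\mathcal{R}$, we can find the data element in $R$ with the maximum weight $w'$ in $Q(|X|)$ time, with high probability.
   Context: The model of computation is the real RAM. The input is a set system $(X,\mathcal{R})$: $X$ is a finite set of $n=|X|$ data elements and $\mathcal{R}$ is a family of subsets of $X$ (the ranges, often given implicitly; e.g. $X\subset\mathbb{R}^3$ and $\mathcal{R}$ is the set of all $h\cap X$ with $h$ a halfspace). Range sampling: each $x\in X$ has a real weight $w(x)$ (for the sampling distribution to be defined, weights are nonnegative and not all zero on the query range). Store $X$ in a data structure so that, given a query range $R\in\mathcal{R}$ and an integer $k$, one can extract $k$ independent random samples from $R$, each equal to $x\in R$ with probability $w(x)/\sum_{y\in R}w(y)$. Here $k=1$. Range maximum: each $x\in X$ has a real weight $w'(x)$. Store $X$ in a data structure so that, given $R\in\mathcal{R}$, one can find an element of $R$ with the maximum weight. "With high probability" means with probability at least $1-n^{ -c}$, where the constant $c>0$ can be chosen arbitrarily large. -}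

module Defs where

open import Algebra.Bundles using (CommutativeRing; Semiring)
open import Algebra.Structures using (IsCommutativeRing)
import Algebra.Definitions.RawSemiring as RawSemiringOps
open import Data.Bool.Base using (Bool; true; false; if_then_else_; _∧_)
open import Data.Fin.Base using (Fin; toℕ)
open import Data.Fin.Subset using (Subset; _∈_; Nonempty)
open import Data.List.Base using (List; length; drop; head; filter; upTo)
open import Data.Maybe using (Maybe; just; nothing; fromMaybe; Is-just)
open import Data.Nat.Base as ℕ using (ℕ; zero; suc; _≡ᵇ_; _<ᵇ_)
open import Data.Product.Base using (Σ; ∃; ∃-syntax; _×_; _,_)
open import Data.Vec.Base using (lookup)
open import Data.Vec.Functional using (Vector)
open import Level using (0ℓ)
open import Relation.Binary.PropositionalEquality.Core using (_≡_; _≢_)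
open import Relation.Binary.Structures using (IsDecTotalOrder)
open import Relation.Nullary.Decidable.Core using (does)
open import Relation.Unary using (Pred; U; ∅; ∁; ⋃; _⊥_; _≐_)

-- The real numbers, axiomatised as a Dedekind-complete totally ordered field.
-- The order is decidable, as the real RAM compares reals in one step; in
-- classical mathematics such a structure exists and is unique up to isomorphism.

record Reals : Set₁ where
  infix  4 _≤_ _<_
  infixl 6 _+_ _-_
  infixl 7 _*_
  infix  8 -_ _⁻¹
  field
    ℝ                 : Set
    _+_ _*_           : ℝ → ℝ → ℝ
    -_                : ℝ → ℝ
    0# 1#             : ℝ
    isCommutativeRing : IsCommutativeRing _≡_ _+_ _*_ -_ 0# 1#
    -- 0# ⁻¹ is an unspecified value
    _⁻¹               : ℝ → ℝ
    *-inverseʳ        : ∀ x → x ≢ 0# → x * x ⁻¹ ≡ 1#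
    0≢1               : 0# ≢ 1#
    _≤_               : ℝ → ℝ → Set
    isDecTotalOrder   : IsDecTotalOrder _≡_ _≤_
    +-monoʳ-≤         : ∀ z {x y} → x ≤ y → z + x ≤ z + y
    *-nonNeg          : ∀ {x y} → 0# ≤ x → 0# ≤ y → 0# ≤ x * y

  _<_ : ℝ → ℝ → Set
  x < y = x ≤ y × x ≢ y

  _-_ : ℝ → ℝ → ℝ
  x - y = x + (- y)

  UpperBound : Pred ℝ 0ℓ → Pred ℝ 0ℓ
  UpperBound A b = ∀ x → A x → x ≤ b

  field
    complete : (A : Pred ℝ 0ℓ) → ∃ A → ∃ (UpperBound A) →
               ∃[ s ] UpperBound A s × (∀ b → UpperBound A b → s ≤ b)

  open IsDecTotalOrder isDecTotalOrder public using (_≤?_; _≟_)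

  commutativeRing : CommutativeRing 0ℓ 0ℓ
  commutativeRing = record { isCommutativeRing = isCommutativeRing }

  open CommutativeRing commutativeRing public
    using (semiring)

  open RawSemiringOps (Semiring.rawSemiring semiring) public
    using (sum; product; _^_) renaming (_×_ to _·_)

  fromℕ : ℕ → ℝ
  fromℕ n = n · 1#

  partialSum : (ℕ → ℝ) → ℕ → ℝ
  partialSum a m = sum {m} (λ i → a (toℕ i))

  ConvergesTo : (ℕ → ℝ) → ℝ → Set
  ConvergesTo a l = ∀ ε → 0# < ε →
    ∃[ N ] (∀ m → N ℕ.≤ m → (l - ε < a m) × (a m < l + ε))

module _ (ℛ : Reals) where
  open Reals ℛ

  record ProbabilitySpace : Set₁ where
    field
      Ω          : Set
      Measurable : Pred Ω 0ℓ → Set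
      U-meas     : Measurable U
      ∁-meas     : ∀ {A} → Measurable A → Measurable (∁ A)
      ⋃-meas     : ∀ {A : ℕ → Pred Ω 0ℓ} → (∀ i → Measurable (A i)) → Measurable (⋃ ℕ A)
      ≐-meas     : ∀ {A B} → A ≐ B → Measurable A → Measurable B
      P          : ∀ {A} → Measurable A → ℝ
      P-cong     : ∀ {A B} (a : Measurable A) (b : Measurable B) → A ≐ B → P a ≡ P b
      P-nonNeg   : ∀ {A} (a : Measurable A) → 0# ≤ P a
      P-∅        : (e : Measurable ∅) → P e ≡ 0#
      P-U        : P U-meas ≡ 1#
      P-σ-additive : ∀ {A : ℕ → Pred Ω 0ℓ} (a : ∀ i → Measurable (A i)) →
                     (∀ i j → i ≢ j → A i ⊥ A j) →
                     ConvergesTo (partialSum (λ i → P (a i))) (P (⋃-meas a))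

    Pr[_]≡_ : Pred Ω 0ℓ → ℝ → Set
    Pr[ A ]≡ p = Σ (Measurable A) λ a → P a ≡ p

    Pr[_]≥_ : Pred Ω 0ℓ → ℝ → Set
    Pr[ A ]≥ p = Σ (Measurable A) λ a → p ≤ P a

  -- ξ 0, ξ 1, … are independent and uniform on [0,1]: the joint distribution
  -- function of any initial segment is the product of the coordinates.
  record RandomSource : Set₁ where
    field
      space : ProbabilitySpace
    open ProbabilitySpace space public
    field
      ξ       : ℕ → Ω → ℝ
      ξ-range : ∀ i ω → (0# ≤ ξ i ω) × (ξ i ω ≤ 1#)
      ξ-iid   : ∀ m (b : Vector ℝ m) → (∀ i → (0# ≤ b i) × (b i ≤ 1#)) →
                Pr[ (λ ω → ∀ i → ξ (toℕ i) ω ≤ b i) ]≡ product b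

-- The real RAM.  Every memory cell holds either a natural number (used for
-- addresses and identifiers) or a real.  There are three memory banks: one
-- initialised with the data structure, one with the query, and a work bank,
-- initially 0, whose cells are also addressed directly as registers.

data Bank : Set where
  structure query work : Bank

infix 4 _==_
_==_ : Bank → Bank → Bool
structure == structure = true
query     == query     = true
work      == work      = true
_         == _         = false

Reg Label : Set
Reg   = ℕ
Label = ℕ

-- The first argument of an arithmetic instruction is its target register.
-- A load or store goes through the address held in a natural-number register.
data Instr : Set where
  const             : Reg → ℕ → Instr
  addℕ subℕ mulℕ    : Reg → Reg → Reg → Instr
  addℝ subℝ mulℝ divℝ : Reg → Reg → Reg → Instr
  ℕ→ℝ               : Reg → Reg → Instr
  loadℕ loadℝ       : (target : Reg) → Bank → (address : Reg) → Instr
  storeℕ storeℝ     : Bank → (address : Reg) → (source : Reg) → Instr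
  randℝ             : Reg → Instr
  randℕ             : (target : Reg) → (bound : Reg) → Instr
  jump              : Label → Instr
  jump<ℕ jump≤ℝ     : Reg → Reg → Label → Instr
  output            : Reg → Instr

Program : Set
Program = List Instr

Memory : Set → Set
Memory A = Bank → ℕ → A

write : ∀ {A} → Bank → ℕ → A → Memory A → Memory A
write b i v M b′ i′ = if (b == b′) ∧ (i ≡ᵇ i′) then v else M b′ i′

nth : ∀ {A : Set} → List A → ℕ → Maybe A
nth xs i = head (drop i xs)

module _ (ℛ : Reals) where
  open Reals ℛ

  record Cells : Set where
    field
      naturals : List ℕ
      reals    : List ℝ

    size : ℕ
    size = length naturals ℕ.+ length reals

  record Config : Set where
    constructor config
    field
      pc    : ℕ
      nats  : Memory ℕ
      rls   : Memory ℝ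
      drawn : ℕ            -- number of random reals consumed so far

  data State : Set where
    running : Config → State
    halted  : ℕ → State
    stuck   : State

  initial : (D q : Cells) → Config
  initial D q = config 0 (load 0 Cells.naturals) (load 0# Cells.reals) 0
    where
    load : ∀ {A : Set} → A → (Cells → List A) → Memory A
    load d f structure i = fromMaybe d (nth (f D) i)
    load d f query     i = fromMaybe d (nth (f q) i)
    load d f work      i = d

  -- ⌊ m u ⌋ for 0 ≤ u < 1, so uniform on {0, …, m - 1} when u is uniform on [0,1]
  bucket : ℕ → ℝ → ℕ
  bucket m u = length (filter (λ i → fromℕ (suc i) ≤? (fromℕ m * u)) (upTo (ℕ.pred m)))

  exec : (u : ℕ → ℝ) → Instr → Config → State
  exec u instr (config pc M R r) = go instr
    where
    n : Reg → ℕ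
    n = M work

    x : Reg → ℝ
    x = R work

    setℕ : Reg → ℕ → State
    setℕ t v = running (config (suc pc) (write work t v M) R r)

    setℝ : Reg → ℝ → State
    setℝ t v = running (config (suc pc) M (write work t v R) r)

    goto : Label → State
    goto l = running (config l M R r)

    go : Instr → State
    go (const t k)      = setℕ t k
    go (addℕ t a b)     = setℕ t (n a ℕ.+ n b)
    go (subℕ t a b)     = setℕ t (n a ℕ.∸ n b)
    go (mulℕ t a b)     = setℕ t (n a ℕ.* n b)
    go (addℝ t a b)     = setℝ t (x a + x b)
    go (subℝ t a b)     = setℝ t (x a - x b)
    go (mulℝ t a b)     = setℝ t (x a * x b)
    go (divℝ t a b)     = if does (x b ≟ 0#) then stuck else setℝ t (x a * x b ⁻¹)
    go (ℕ→ℝ t a)        = setℝ t (fromℕ (n a))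
    go (loadℕ t β a)    = setℕ t (M β (n a))
    go (loadℝ t β a)    = setℝ t (R β (n a))
    go (storeℕ β a s)   = running (config (suc pc) (write β (n a) (n s) M) R r)
    go (storeℝ β a s)   = running (config (suc pc) M (write β (n a) (x s) R) r)
    go (randℝ t)        = running (config (suc pc) M (write work t (u r) R) (suc r))
    go (randℕ t a)      =
      running (config (suc pc) (write work t (bucket (n a) (u r)) M) R (suc r))
    go (jump l)         = goto l
    go (jump<ℕ a b l)   = if n a <ᵇ n b then goto l else goto (suc pc)
    go (jump≤ℝ a b l)   = if does (x a ≤? x b) then goto l else goto (suc pc)
    go (output a)       = halted (n a)

  step : Program → (ℕ → ℝ) → Config → State
  step p u c with nth p (Config.pc c)
  ... | just instr = exec u instr c
  ... | nothing    = stuck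

  -- The output, provided the program halts within t steps.
  run : Program → (u : ℕ → ℝ) → (t : ℕ) → Config → Maybe ℕ
  run p u zero    c = nothing
  run p u (suc t) c with step p u c
  ... | running c′ = run p u t c′
  ... | halted k   = just k
  ... | stuck      = nothing

-- The ground set is Fin n; the family of ranges is indexed by Range.
record SetSystem : Set₁ where
  field
    n     : ℕ
    Range : Set
    ⟦_⟧   : Range → Subset n

  X : Set
  X = Fin n

module _ (ℛ : Reals) (𝒰 : RandomSource ℛ) (𝒮 : SetSystem) where
  open Reals ℛ
  open RandomSource 𝒰
  open SetSystem 𝒮

  weight : (X → ℝ) → Subset n → ℝ
  weight w R = sum (λ x → if lookup R x then w x else 0#)

  IsMaximum : (X → ℝ) → Subset n → X → Set
  IsMaximum w R x = x ∈ R × (∀ y → y ∈ R → w y ≤ w x)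

  -- Queries are presented to the machine through an arbitrary encoding, for
  -- example the coefficients of a halfspace.
  module _ (encode : Range → Cells ℛ) where

    answer : Program → Cells ℛ → Range → (t : ℕ) → Ω → Maybe ℕ
    answer p D q t ω = run ℛ p (λ i → ξ i ω) t (initial ℛ D (encode q))

    HaltsWithin : ℕ → Program → Cells ℛ → Range → Set
    HaltsWithin t p D q = ∀ ω → Is-just (answer p D q t ω)

    -- The query program is chosen before the weights, which it can only
    -- access through the data structure.

    RangeSampling : (S Q : ℕ → ℕ) → Set
    RangeSampling S Q =
      ∃[ p ] ∀ (w : X → ℝ) → (∀ x → 0# ≤ w x) →
      ∃[ D ] Cells.size D ℕ.≤ S n ×
        (∀ (q : Range) → 0# < weight w ⟦ q ⟧ →
          HaltsWithin (Q n) p D q ×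
          (∀ x → x ∈ ⟦ q ⟧ →
            Pr[ (λ ω → answer p D q (Q n) ω ≡ just (toℕ x)) ]≡
              (w x * weight w ⟦ q ⟧ ⁻¹)))

    RangeMaximum : (S Q : ℕ → ℕ) → (c : ℕ) → Set
    RangeMaximum S Q c =
      ∃[ p ] ∀ (w′ : X → ℝ) →
      ∃[ D ] Cells.size D ℕ.≤ S n ×
        (∀ (q : Range) → Nonempty ⟦ q ⟧ →
          HaltsWithin (Q n) p D q ×
          Pr[ (λ ω → ∃[ x ] IsMaximum w′ ⟦ q ⟧ x ×
                            answer p D q (Q n) ω ≡ just (toℕ x)) ]≥
            (1# - (fromℕ n ^ c) ⁻¹))

{-# OPTIONS --safe #-}
module Submission where

-- Sample with weights w(x) = n^((c + 1) rank(x)), where rank(x) is the number of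
-- elements with smaller w′-weight.  If x in R is not a maximum, then some y in R
-- has larger rank, so w(x) is at most n^-(c+1) times the total weight of R.
-- Summing over the at most n such x, a sample misses the maximum with
-- probability at most n^-c.

open import Defs
open import Data.Nat.Base using (ℕ; _<_)

import Algebra.Properties.Ring as RingProperties
import Algebra.Properties.Semiring.Mult as SemiringMult
import Algebra.Properties.Semiring.Sum as SemiringSum
open import Algebra.Bundles using (CommutativeRing)
open import Data.Bool.Base using (true; false; if_then_else_)
open import Data.Empty using (⊥-elim)
open import Data.Fin.Base using (Fin; zero; suc; toℕ)
open import Data.Fin.Properties using (toℕ-injective; ¬∀⟶∃¬; all?)
open import Data.Fin.Subset using (Subset; _∈_; _∉_; ∣_∣; Nonempty)
open import Data.Fin.Subset.Properties using (_∈?_; p⊂q⇒∣p∣<∣q∣)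
open import Data.Maybe.Base using (just)
open import Data.Maybe.Properties using (just-injective)
open import Data.Nat.Base using (zero; suc; z≤n; s≤s; _⊔_) renaming (_≤_ to _≤ℕ_)
open import Data.Nat.Properties using (m≤m⊔n; m≤n⊔m)
open import Data.Product.Base using (∃-syntax; _×_; _,_; proj₁; proj₂)
open import Data.Sum.Base using (inj₁; inj₂)
open import Data.Vec.Base using (lookup; tabulate)
open import Data.Vec.Functional using (Vector)
open import Data.Vec.Properties using ([]=⇒lookup; lookup⇒[]=; lookup∘tabulate)
open import Function.Base using (_∘_)
open import Level using (0ℓ)
open import Relation.Binary.Bundles using (Poset)
open import Relation.Binary.PropositionalEquality
  using (_≡_; _≢_; refl; sym; trans; cong; cong₂; subst; subst₂; module ≡-Reasoning)
open import Relation.Binary.Structures using (IsDecTotalOrder)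
open import Relation.Nullary using (¬_; Dec; yes; no; does; contradiction)
open import Relation.Nullary.Decidable using (¬?; _×-dec_; _→-dec_; dec-true)
open import Relation.Unary using (Pred; ∅; ⋃; _⊥_; _≐_)
import Relation.Binary.Reasoning.PartialOrder as PartialOrderReasoning

-- Finite families continued to sequences, and subsets given by decidable predicates.

pad : ∀ {a} {A : Set a} {n} → A → Vector A n → ℕ → A
pad {n = zero}  d f i       = d
pad {n = suc n} d f zero    = f zero
pad {n = suc n} d f (suc i) = pad d (f ∘ suc) i

∈-tabulate⁺ : ∀ {n} {P : Pred (Fin n) 0ℓ} (P? : ∀ x → Dec (P x)) {x} →
              P x → x ∈ tabulate (does ∘ P?)
∈-tabulate⁺ P? {x} Px = lookup⇒[]= x _
  (trans (lookup∘tabulate (does ∘ P?) x) (dec-true (P? x) Px))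

∈-tabulate⁻ : ∀ {n} {P : Pred (Fin n) 0ℓ} (P? : ∀ x → Dec (P x)) {x} →
              x ∈ tabulate (does ∘ P?) → P x
∈-tabulate⁻ P? {x} x∈ with P? x | trans (sym (lookup∘tabulate (does ∘ P?) x)) ([]=⇒lookup x∈)
... | yes Px | _ = Px
... | no _   | ()

-- Arithmetic in the ordered field of reals.

module RealsProperties (ℛ : Reals) where
  open Reals ℛ renaming (_<_ to _<ʳ_) public
  open CommutativeRing commutativeRing public
    using ( ring; +-comm; +-identityˡ; +-identityʳ; -‿inverseʳ
          ; *-comm; *-assoc; *-identityˡ; *-identityʳ; zeroˡ; zeroʳ; distribʳ )
  open RingProperties ring public
    using (-‿involutive; -‿distribˡ-*; x[y-z]≈xy-xz)
    renaming ( //-rightDividesˡ to x-y+y≡x; //-rightDividesʳ to x+y-y≡x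
             ; x∙y⁻¹≈ε⇒x≈y to x-y≡0⇒x≡y )
  open SemiringMult semiring public using (×-assoc-*)
  open SemiringSum semiring public
    using (sum-cong-≗; ∑-distrib-+; *-distribʳ-sum; sum-replicate; sum-replicate-zero)
  open IsDecTotalOrder isDecTotalOrder public
    using (isPartialOrder; total; antisym)
    renaming (refl to ≤-refl; reflexive to ≤-reflexive; trans to ≤-trans)

  ≤-poset : Poset 0ℓ 0ℓ 0ℓ
  ≤-poset = record { isPartialOrder = isPartialOrder }

  module ≤-Reasoning = PartialOrderReasoning ≤-poset

  +-monoˡ-≤ : ∀ z {x y} → x ≤ y → x + z ≤ y + z
  +-monoˡ-≤ z {x} {y} x≤y = subst₂ _≤_ (+-comm z x) (+-comm z y) (+-monoʳ-≤ z x≤y)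

  +-mono-≤ : ∀ {x y u v} → x ≤ y → u ≤ v → x + u ≤ y + v
  +-mono-≤ {y = y} {u} x≤y u≤v = ≤-trans (+-monoˡ-≤ u x≤y) (+-monoʳ-≤ y u≤v)

  x≤y⇒0≤y-x : ∀ {x y} → x ≤ y → 0# ≤ y - x
  x≤y⇒0≤y-x {x} {y} x≤y = subst (_≤ y - x) (-‿inverseʳ x) (+-monoˡ-≤ (- x) x≤y)

  0≤y-x⇒x≤y : ∀ {x y} → 0# ≤ y - x → x ≤ y
  0≤y-x⇒x≤y {x} {y} h = subst₂ _≤_ (+-identityˡ x) (x-y+y≡x x y) (+-monoˡ-≤ x h)

  x≤y+z⇒x-z≤y : ∀ {x y z} → x ≤ y + z → x - z ≤ y
  x≤y+z⇒x-z≤y {x} {y} {z} h = subst (x - z ≤_) (x+y-y≡x z y) (+-monoˡ-≤ (- z) h)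

  x≤x+y : ∀ {x y} → 0# ≤ y → x ≤ x + y
  x≤x+y {x} {y} 0≤y = subst (_≤ x + y) (+-identityʳ x) (+-monoʳ-≤ x 0≤y)

  x≤y+x : ∀ {x y} → 0# ≤ y → x ≤ y + x
  x≤y+x {x} {y} 0≤y = subst (x ≤_) (+-comm x y) (x≤x+y 0≤y)

  x≤0⇒0≤-x : ∀ {x} → x ≤ 0# → 0# ≤ - x
  x≤0⇒0≤-x x≤0 = subst (0# ≤_) (+-identityˡ _) (x≤y⇒0≤y-x x≤0)

  *-monoʳ-≤ : ∀ {x y} z → 0# ≤ z → x ≤ y → z * x ≤ z * y
  *-monoʳ-≤ {x} {y} z 0≤z x≤y = 0≤y-x⇒x≤y
    (subst (0# ≤_) (x[y-z]≈xy-xz z y x) (*-nonNeg 0≤z (x≤y⇒0≤y-x x≤y)))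

  *-monoˡ-≤ : ∀ {x y} z → 0# ≤ z → x ≤ y → x * z ≤ y * z
  *-monoˡ-≤ {x} {y} z 0≤z x≤y =
    subst₂ _≤_ (*-comm z x) (*-comm z y) (*-monoʳ-≤ z 0≤z x≤y)

  -- Otherwise -1 would be nonnegative, and so would its square, which is 1.
  0≤1 : 0# ≤ 1#
  0≤1 with total 0# 1#
  ... | inj₁ 0≤1 = 0≤1
  ... | inj₂ 1≤0 = subst (0# ≤_) -1*-1≡1 (*-nonNeg 0≤-1 0≤-1)
    where
    0≤-1 : 0# ≤ - 1#
    0≤-1 = x≤0⇒0≤-x 1≤0

    -1*-1≡1 : - 1# * - 1# ≡ 1#
    -1*-1≡1 = trans (sym (-‿distribˡ-* 1# (- 1#)))
                    (trans (cong -_ (*-identityˡ (- 1#))) (-‿involutive 1#))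

  1≤x⇒0≤x : ∀ {x} → 1# ≤ x → 0# ≤ x
  1≤x⇒0≤x = ≤-trans 0≤1

  1≤x⇒x≢0 : ∀ {x} → 1# ≤ x → x ≢ 0#
  1≤x⇒x≢0 1≤x refl = 0≢1 (antisym 0≤1 1≤x)

  1≤x⇒0<x : ∀ {x} → 1# ≤ x → 0# <ʳ x
  1≤x⇒0<x 1≤x = 1≤x⇒0≤x 1≤x , 1≤x⇒x≢0 1≤x ∘ sym

  <⇒≱ : ∀ {x y} → x <ʳ y → ¬ y ≤ x
  <⇒≱ (x≤y , x≢y) y≤x = x≢y (antisym x≤y y≤x)

  <-≤-trans : ∀ {x y z} → x <ʳ y → y ≤ z → x <ʳ z
  <-≤-trans x<y y≤z = ≤-trans (proj₁ x<y) y≤z , λ { refl → <⇒≱ x<y y≤z }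

  x<y⇒0<y-x : ∀ {x y} → x <ʳ y → 0# <ʳ y - x
  x<y⇒0<y-x {x} {y} (x≤y , x≢y) =
    x≤y⇒0≤y-x x≤y , λ 0≡y-x → x≢y (sym (x-y≡0⇒x≡y y x (sym 0≡y-x)))

  -- If `x ⁻¹ ≤ 0#`, multiplying by `x` gives `1# ≤ 0#`.
  0<x⇒0≤x⁻¹ : ∀ {x} → 0# <ʳ x → 0# ≤ x ⁻¹
  0<x⇒0≤x⁻¹ {x} (0≤x , 0≢x) with total 0# (x ⁻¹)
  ... | inj₁ 0≤x⁻¹ = 0≤x⁻¹
  ... | inj₂ x⁻¹≤0 = contradiction (antisym 0≤1 1≤0) 0≢1
    where
    1≤0 : 1# ≤ 0#
    1≤0 = subst₂ _≤_ (*-inverseʳ x (0≢x ∘ sym)) (zeroʳ x) (*-monoʳ-≤ x 0≤x x⁻¹≤0)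

  1≤x*y : ∀ {x y} → 1# ≤ x → 1# ≤ y → 1# ≤ x * y
  1≤x*y {x} {y} 1≤x 1≤y =
    ≤-trans 1≤x (subst (_≤ x * y) (*-identityʳ x) (*-monoʳ-≤ x (1≤x⇒0≤x 1≤x) 1≤y))

  1≤x^k : ∀ {x} k → 1# ≤ x → 1# ≤ x ^ k
  1≤x^k zero    1≤x = ≤-refl
  1≤x^k (suc k) 1≤x = 1≤x*y 1≤x (1≤x^k k 1≤x)

  ^-monoʳ-≤ : ∀ {x j k} → 1# ≤ x → j ≤ℕ k → x ^ j ≤ x ^ k
  ^-monoʳ-≤ {k = k} 1≤x z≤n       = 1≤x^k k 1≤x
  ^-monoʳ-≤ {x}     1≤x (s≤s j≤k) = *-monoʳ-≤ x (1≤x⇒0≤x 1≤x) (^-monoʳ-≤ 1≤x j≤k)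

  0≤fromℕ : ∀ n → 0# ≤ fromℕ n
  0≤fromℕ zero    = ≤-refl
  0≤fromℕ (suc n) = ≤-trans 0≤1 (x≤x+y (0≤fromℕ n))

  -- An element of `Fin n` certifies that `n` is positive; the arguments of type `X` further on are
  -- passed for the same purpose.
  1≤fromℕ : ∀ {n} → Fin n → 1# ≤ fromℕ n
  1≤fromℕ {suc n} _ = x≤x+y (0≤fromℕ n)

  -- Finite sums of reals.

  sum-nonNeg : ∀ {n} (f : Vector ℝ n) → (∀ i → 0# ≤ f i) → 0# ≤ sum f
  sum-nonNeg {zero}  f 0≤f = ≤-refl
  sum-nonNeg {suc n} f 0≤f =
    ≤-trans (0≤f zero) (x≤x+y (sum-nonNeg (f ∘ suc) (0≤f ∘ suc)))

  sum-mono-≤ : ∀ {n} (f g : Vector ℝ n) → (∀ i → f i ≤ g i) → sum f ≤ sum g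
  sum-mono-≤ {zero}  f g f≤g = ≤-refl
  sum-mono-≤ {suc n} f g f≤g =
    +-mono-≤ (f≤g zero) (sum-mono-≤ (f ∘ suc) (g ∘ suc) (f≤g ∘ suc))

  term≤sum : ∀ {n} (f : Vector ℝ n) → (∀ i → 0# ≤ f i) → ∀ i → f i ≤ sum f
  term≤sum f 0≤f zero    = x≤x+y (sum-nonNeg (f ∘ suc) (0≤f ∘ suc))
  term≤sum f 0≤f (suc i) = ≤-trans (term≤sum (f ∘ suc) (0≤f ∘ suc) i) (x≤y+x (0≤f zero))

  sum-const : ∀ n x → sum {n} (λ _ → x) ≡ fromℕ n * x
  sum-const n x = trans (sum-replicate n)
    (trans (cong (n ·_) (sym (*-identityˡ x))) (sym (×-assoc-* n 1# x)))

  -- Limits of eventually constant sequences.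

  partialSum-pad : ∀ {n} (p : Vector ℝ n) {m} → n ≤ℕ m → partialSum (pad 0# p) m ≡ sum p
  partialSum-pad p {m} z≤n = sum-replicate-zero m
  partialSum-pad p (s≤s n≤m) = cong (p zero +_) (partialSum-pad (p ∘ suc) n≤m)

  -- If `l` differed from `v`, the tolerance |v - l| would put `a m` strictly inside an interval
  -- around `l` that has `v` as an endpoint. At the maximum of the two thresholds `a m` equals `v`,
  -- so `v` would be strictly less than itself.
  eventually-constant : ∀ {a l v} n → ConvergesTo a l → (∀ {m} → n ≤ℕ m → a m ≡ v) → l ≡ v
  eventually-constant {a} {l} {v} n a→l a≡v with l ≟ v
  ... | yes l≡v = l≡v
  ... | no  l≢v with total l v
  ...   | inj₁ l≤v = ⊥-elim (proj₂ v<v refl)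
    where
    lim : ∃[ N ] (∀ m → N ≤ℕ m → (l - (v - l) <ʳ a m) × (a m <ʳ l + (v - l)))
    lim = a→l (v - l) (x<y⇒0<y-x (l≤v , l≢v))

    v<v : v <ʳ v
    v<v = subst₂ _<ʳ_ (a≡v (m≤m⊔n n _)) (trans (+-comm l _) (x-y+y≡x l v))
            (proj₂ (proj₂ lim _ (m≤n⊔m n _)))
  ...   | inj₂ v≤l = ⊥-elim (proj₂ v<v refl)
    where
    lim : ∃[ N ] (∀ m → N ≤ℕ m → (l - (l - v) <ʳ a m) × (a m <ʳ l + (l - v)))
    lim = a→l (l - v) (x<y⇒0<y-x (v≤l , l≢v ∘ sym))

    l-[l-v]≡v : l - (l - v) ≡ v
    l-[l-v]≡v = trans (cong (_- (l - v)) (trans (sym (x-y+y≡x v l)) (+-comm _ v)))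
                      (x+y-y≡x (l - v) v)

    v<v : v <ʳ v
    v<v = subst₂ _<ʳ_ l-[l-v]≡v (a≡v (m≤m⊔n n _))
            (proj₁ (proj₂ lim _ (m≤n⊔m n _)))

-- Finite additivity derived from countable additivity.

module ProbabilityProperties (ℛ : Reals) (𝒫 : ProbabilitySpace ℛ) where
  open RealsProperties ℛ
  open ProbabilitySpace 𝒫

  Pr-cong : ∀ {A B p} → A ≐ B → Pr[ A ]≡ p → Pr[ B ]≡ p
  Pr-cong A≐B@(A⊆B , B⊆A) (a , Pa≡p) =
    ≐-meas A≐B a , trans (P-cong _ a (B⊆A , A⊆B)) Pa≡p

  Pr-∅ : Pr[ ∅ ]≡ 0#
  Pr-∅ = ∅-meas , P-∅ ∅-meas
    where
    ∅-meas : Measurable ∅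
    ∅-meas = ≐-meas ((λ ¬U → ¬U _) , λ ()) (∁-meas U-meas)

  -- Countable additivity speaks of sequences, so a finite family of events is continued by empty
  -- events, and its probabilities by zeros.
  Pr-pad : ∀ {n} (E : Fin n → Pred Ω 0ℓ) (p : Vector ℝ n) →
           (∀ x → Pr[ E x ]≡ p x) → ∀ i → Pr[ pad ∅ E i ]≡ pad 0# p i
  Pr-pad {zero}  E p PrE i       = Pr-∅
  Pr-pad {suc n} E p PrE zero    = PrE zero
  Pr-pad {suc n} E p PrE (suc i) = Pr-pad (E ∘ suc) (p ∘ suc) (PrE ∘ suc) i

  ∈-pad⁻ : ∀ {n} (E : Fin n → Pred Ω 0ℓ) i {ω} →
           pad ∅ E i ω → ∃[ x ] toℕ x ≡ i × E x ω
  ∈-pad⁻ {suc n} E zero    Eω = zero , refl , Eω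
  ∈-pad⁻ {suc n} E (suc i) Eω with ∈-pad⁻ (E ∘ suc) i Eω
  ... | x , refl , Exω = suc x , refl , Exω

  ∈-pad⁺ : ∀ {n} (E : Fin n → Pred Ω 0ℓ) x {ω} → E x ω → pad ∅ E (toℕ x) ω
  ∈-pad⁺ E zero    Eω = Eω
  ∈-pad⁺ E (suc x) Eω = ∈-pad⁺ (E ∘ suc) x Eω

  -- The padded sequence is still disjoint and has the same union. Its partial sums equal `sum p`
  -- from index `n` on, so that is their limit.
  P-additive : ∀ {n} (E : Fin n → Pred Ω 0ℓ) (p : Vector ℝ n) →
               (∀ x y → x ≢ y → E x ⊥ E y) → (∀ x → Pr[ E x ]≡ p x) →
               Pr[ ⋃ (Fin n) E ]≡ sum p
  P-additive {n} E p disjoint PrE = Pr-cong padded≐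
    (⋃-meas meas , eventually-constant n (P-σ-additive meas pad-disjoint) stable)
    where
    meas : ∀ i → Measurable (pad ∅ E i)
    meas i = proj₁ (Pr-pad E p PrE i)

    padded≐ : ⋃ ℕ (pad ∅ E) ≐ ⋃ (Fin n) E
    padded≐ = (λ (i , Eω) → let (x , _ , Exω) = ∈-pad⁻ E i Eω in x , Exω)
            , (λ (x , Exω) → toℕ x , ∈-pad⁺ E x Exω)

    pad-disjoint : ∀ i j → i ≢ j → pad ∅ E i ⊥ pad ∅ E j
    pad-disjoint i j i≢j (Ei , Ej) with ∈-pad⁻ E i Ei | ∈-pad⁻ E j Ej
    ... | x , refl , Ex | y , refl , Ey = disjoint x y (i≢j ∘ cong toℕ) (Ex , Ey)

    stable : ∀ {m} → n ≤ℕ m → partialSum (λ i → P (meas i)) m ≡ sum p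
    stable {m} n≤m = trans
      (sum-cong-≗ {m} (λ i → proj₂ (Pr-pad E p PrE (toℕ i)))) (partialSum-pad p n≤m)

-- Ranks of elements under the weight to be maximised.

module Rank (ℛ : Reals) {n : ℕ} (w′ : Fin n → Reals.ℝ ℛ) where
  open RealsProperties ℛ

  -- As the order is total, the negation says that `w′ y` is strictly smaller than `w′ x`. Elements
  -- of equal weight thus receive equal rank.
  below? : ∀ x y → Dec (¬ w′ x ≤ w′ y)
  below? x y = ¬? (w′ x ≤? w′ y)

  below : Fin n → Subset n
  below x = tabulate (does ∘ below? x)

  rank : Fin n → ℕ
  rank x = ∣ below x ∣

  -- Whatever lies strictly below `x` lies strictly below `y`, and `x` itself is below `y` but not
  -- below `x`, so the inclusion is proper.
  rank-strict : ∀ {x y} → ¬ w′ y ≤ w′ x → rank x < rank y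
  rank-strict {x} {y} y≰x = p⊂q⇒∣p∣<∣q∣ (below⊆ , x , x∈ , x∉)
    where
    x≤y : w′ x ≤ w′ y
    x≤y with total (w′ x) (w′ y)
    ... | inj₁ x≤y = x≤y
    ... | inj₂ y≤x = contradiction y≤x y≰x

    below⊆ : ∀ {z} → z ∈ below x → z ∈ below y
    below⊆ z∈ = ∈-tabulate⁺ (below? y) (∈-tabulate⁻ (below? x) z∈ ∘ ≤-trans x≤y)

    x∈ : x ∈ below y
    x∈ = ∈-tabulate⁺ (below? y) y≰x

    x∉ : x ∉ below x
    x∉ x∈ = ∈-tabulate⁻ (below? x) x∈ ≤-refl

-- Maxima of a range and the weight of a range.

module _ (ℛ : Reals) (𝒰 : RandomSource ℛ) (𝒮 : SetSystem) where
  open RealsProperties ℛ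
  open RandomSource 𝒰 using (space)
  open ProbabilityProperties ℛ space
  open SetSystem 𝒮

  -- Abstract so that case analysis on the decision also rewrites its does field.
  abstract
    maximum? : ∀ w′ R x → Dec (IsMaximum ℛ 𝒰 𝒮 w′ R x)
    maximum? w′ R x = x ∈? R ×-dec all? (λ y → y ∈? R →-dec w′ y ≤? w′ x)

  -- The ground set is finite and membership and order are decidable, so a failing universal
  -- statement yields an explicit counterexample.
  outranked : ∀ w′ R {x} → x ∈ R → ¬ IsMaximum ℛ 𝒰 𝒮 w′ R x →
              ∃[ y ] y ∈ R × ¬ (w′ y ≤ w′ x)
  outranked w′ R {x} x∈R ¬max
    with ¬∀⟶∃¬ n _ (λ y → y ∈? R →-dec w′ y ≤? w′ x) (λ max → ¬max (x∈R , max))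
  ... | y , ¬imp with y ∈? R
  ...   | yes y∈R = y , y∈R , λ y≤x → ¬imp (λ _ → y≤x)
  ...   | no  y∉R = ⊥-elim (¬imp (λ y∈R → contradiction y∈R y∉R))

  module _ {w : X → ℝ} (0≤w : ∀ x → 0# ≤ w x) (R : Subset n) where

    restricted-nonNeg : ∀ x → 0# ≤ (if lookup R x then w x else 0#)
    restricted-nonNeg x with lookup R x
    ... | true  = 0≤w x
    ... | false = ≤-refl

    member≤weight : ∀ {x} → x ∈ R → w x ≤ weight ℛ 𝒰 𝒮 w R
    member≤weight {x} x∈R =
      subst (λ b → (if b then w x else 0#) ≤ weight ℛ 𝒰 𝒮 w R) ([]=⇒lookup x∈R)
            (term≤sum _ restricted-nonNeg x)

  -- Summed over `X` and divided by the weight of `R`, this is the probability that a sample from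
  -- `R` is a maximum.
  maximumWeight : (w′ w : X → ℝ) → Subset n → X → ℝ
  maximumWeight w′ w R x = if does (maximum? w′ R x) then w x else 0#

  -- The rank weights and the bound on the failure probability.

  module _ (w′ : X → ℝ) (c : ℕ) where
    open Rank ℛ w′

    -- The exponent of `base` exceeds `c` by one: the extra factor `N` pays for adding up `n` error
    -- terms.
    N base failure : ℝ
    N       = fromℕ n
    base    = N ^ suc c
    failure = (N ^ c) ⁻¹

    rankWeight : X → ℝ
    rankWeight x = base ^ rank x

    1≤base : X → 1# ≤ base
    1≤base x = 1≤x^k (suc c) (1≤fromℕ x)

    base*base⁻¹≡1 : X → base * base ⁻¹ ≡ 1#
    base*base⁻¹≡1 x = *-inverseʳ base (1≤x⇒x≢0 (1≤base x))

    0≤base⁻¹ : X → 0# ≤ base ⁻¹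
    0≤base⁻¹ x = 0<x⇒0≤x⁻¹ (1≤x⇒0<x (1≤base x))

    n*base⁻¹≡failure : X → N * base ⁻¹ ≡ failure
    n*base⁻¹≡failure x = begin
      N * base ⁻¹                       ≡⟨ *-identityʳ _ ⟨
      -- Writing 1 as `N ^ c * failure` supplies the `N ^ c` that completes `N` to `base`.
      N * base ⁻¹ * 1#                  ≡⟨ cong (N * base ⁻¹ *_) (*-inverseʳ (N ^ c) N^c≢0) ⟨
      N * base ⁻¹ * (N ^ c * failure)   ≡⟨ *-assoc _ _ _ ⟨
      N * base ⁻¹ * N ^ c * failure     ≡⟨ cong (_* failure) N-factor ⟩
      base * base ⁻¹ * failure          ≡⟨ cong (_* failure) (base*base⁻¹≡1 x) ⟩
      1# * failure                      ≡⟨ *-identityˡ failure ⟩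
      failure                           ∎
      where
      open ≡-Reasoning

      N-factor : N * base ⁻¹ * N ^ c ≡ base * base ⁻¹
      N-factor = trans (*-assoc N _ _)
        (trans (cong (N *_) (*-comm _ _)) (sym (*-assoc N _ _)))

      N^c≢0 : N ^ c ≢ 0#
      N^c≢0 = 1≤x⇒x≢0 (1≤x^k c (1≤fromℕ x))

    1≤rankWeight : ∀ x → 1# ≤ rankWeight x
    1≤rankWeight x = 1≤x^k (rank x) (1≤base x)

    rankWeight-nonNeg : ∀ x → 0# ≤ rankWeight x
    rankWeight-nonNeg x = 1≤x⇒0≤x (1≤rankWeight x)

    module _ (R : Subset n) where
      W M : ℝ
      W = weight ℛ 𝒰 𝒮 rankWeight R
      M = sum (maximumWeight w′ rankWeight R)

      W-nonNeg : 0# ≤ W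
      W-nonNeg = sum-nonNeg _ (restricted-nonNeg rankWeight-nonNeg R)

      -- Every rank weight is at least 1. Positivity is what a sampling query requires of its range.
      W-positive : Nonempty R → 0# <ʳ W
      W-positive (x , x∈R) = <-≤-trans (1≤x⇒0<x (1≤rankWeight x))
        (member≤weight rankWeight-nonNeg R x∈R)

      -- Some `y` in `R` has larger rank, so it weighs at least `base` times as much as `x`, and its
      -- weight is part of `W`.
      nonmaximum-light : ∀ {x} → x ∈ R → ¬ IsMaximum ℛ 𝒰 𝒮 w′ R x →
                         rankWeight x ≤ base ⁻¹ * W
      nonmaximum-light {x} x∈R ¬max with outranked w′ R x∈R ¬max
      ... | y , y∈R , y≰x = begin
        rankWeight x                       ≡⟨ *-identityˡ _ ⟨
        1# * rankWeight x                  ≡⟨ cong (_* rankWeight x) (base*base⁻¹≡1 x) ⟨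
        (base * base ⁻¹) * rankWeight x    ≡⟨ cong (_* rankWeight x) (*-comm base _) ⟩
        (base ⁻¹ * base) * rankWeight x    ≡⟨ *-assoc _ _ _ ⟩
        -- `base * rankWeight x` is `base ^ suc (rank x)` by definition, and `rank x < rank y` means
        -- `suc (rank x) ≤ rank y`.
        base ⁻¹ * base ^ suc (rank x)      ≤⟨ *-monoʳ-≤ _ (0≤base⁻¹ x) (^-monoʳ-≤ (1≤base x) (rank-strict y≰x)) ⟩
        base ⁻¹ * rankWeight y             ≤⟨ *-monoʳ-≤ _ (0≤base⁻¹ x) (member≤weight rankWeight-nonNeg R y∈R) ⟩
        base ⁻¹ * W                        ∎
        where open ≤-Reasoning

      light-nonNeg : X → 0# ≤ base ⁻¹ * W
      light-nonNeg x = *-nonNeg (0≤base⁻¹ x) W-nonNeg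

      -- A maximum is covered by the first summand, another element of `R` by the second, and an
      -- element outside `R` contributes 0. The error term is granted to every `x`, so that it sums
      -- to a plain multiple.
      restricted-bound : ∀ x → (if lookup R x then rankWeight x else 0#) ≤
                               maximumWeight w′ rankWeight R x + base ⁻¹ * W
      restricted-bound x with maximum? w′ R x | lookup R x in eq
      ... | yes _         | true  = x≤x+y (light-nonNeg x)
      -- A maximum belongs to `R`, so this case cannot occur.
      ... | yes (x∈R , _) | false = contradiction (trans (sym eq) ([]=⇒lookup x∈R)) λ ()
      ... | no ¬max       | true  = ≤-trans
        (nonmaximum-light (lookup⇒[]= x R eq) ¬max)
        (≤-reflexive (sym (+-identityˡ (base ⁻¹ * W))))
      ... | no _          | false = ≤-trans (light-nonNeg x) (x≤y+x ≤-refl)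

      -- In the sum of the termwise bounds, the `n` error terms add up to `N * base ⁻¹ * W`, which
      -- is `failure * W`.
      weight-bound : X → W ≤ M + failure * W
      weight-bound x = begin
        W
          ≤⟨ sum-mono-≤ _ _ restricted-bound ⟩
        sum (λ x → maximumWeight w′ rankWeight R x + base ⁻¹ * W)
          ≡⟨ ∑-distrib-+ (maximumWeight w′ rankWeight R) (λ _ → base ⁻¹ * W) ⟩
        M + sum {n} (λ _ → base ⁻¹ * W)
          ≡⟨ cong (M +_) (sum-const n (base ⁻¹ * W)) ⟩
        M + N * (base ⁻¹ * W)
          ≡⟨ cong (M +_) (trans (sym (*-assoc _ _ _)) (cong (_* W) (n*base⁻¹≡failure x))) ⟩
        M + failure * W
          ∎
        where open ≤-Reasoning

      -- This is the weight bound divided by `W`.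
      success-bound : Nonempty R →
                      1# - failure ≤ sum (λ x → maximumWeight w′ rankWeight R x * W ⁻¹)
      success-bound R≢∅@(x , _) = x≤y+z⇒x-z≤y (begin
        1#                                  ≡⟨ W*W⁻¹≡1 ⟨
        W * W ⁻¹                            ≤⟨ *-monoˡ-≤ (W ⁻¹) (0<x⇒0≤x⁻¹ W>0) (weight-bound x) ⟩
        (M + failure * W) * W ⁻¹            ≡⟨ distribʳ (W ⁻¹) M _ ⟩
        M * W ⁻¹ + failure * W * W ⁻¹       ≡⟨ cong (M * W ⁻¹ +_) (*-assoc failure W _) ⟩
        M * W ⁻¹ + failure * (W * W ⁻¹)     ≡⟨ cong (λ z → M * W ⁻¹ + failure * z) W*W⁻¹≡1 ⟩
        M * W ⁻¹ + failure * 1#             ≡⟨ cong₂ _+_ (*-distribʳ-sum (W ⁻¹) (maximumWeight w′ rankWeight R)) (*-identityʳ failure) ⟩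
        sum (λ x → maximumWeight w′ rankWeight R x * W ⁻¹) + failure ∎)
        where
        open ≤-Reasoning
        W>0 : 0# <ʳ W
        W>0 = W-positive R≢∅

        W*W⁻¹≡1 : W * W ⁻¹ ≡ 1#
        W*W⁻¹≡1 = *-inverseʳ W (proj₂ W>0 ∘ sym)

-- The reduction of range maximum to range sampling.

lemma2 : (ℛ : Reals) (𝒰 : RandomSource ℛ)
    (𝒮 : SetSystem) (encode : SetSystem.Range 𝒮 → Cells ℛ)
    (S Q : ℕ → ℕ) →
    RangeSampling ℛ 𝒰 𝒮 encode S Q →
    (c : ℕ) → 0 < c → RangeMaximum ℛ 𝒰 𝒮 encode S Q c
-- The sampling program answers maximum queries unchanged: it is fixed before the weights, and only
-- the stored structure depends on `w′`. Space and time therefore carry over exactly.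
lemma2 ℛ 𝒰 𝒮 encode S Q (p , sampling) c _ = p , structureFor
  where
  open RealsProperties ℛ
  open RandomSource 𝒰 using (space; Ω; Pr[_]≡_; Pr[_]≥_)
  open ProbabilityProperties ℛ space
  open SetSystem 𝒮

  structureFor : ∀ w′ → ∃[ D ] Cells.size D ≤ℕ S n ×
    (∀ q → Nonempty ⟦ q ⟧ →
      HaltsWithin ℛ 𝒰 𝒮 encode (Q n) p D q ×
      Pr[ (λ ω → ∃[ x ] IsMaximum ℛ 𝒰 𝒮 w′ ⟦ q ⟧ x ×
                        answer ℛ 𝒰 𝒮 encode p D q (Q n) ω ≡ just (toℕ x)) ]≥
        (1# - (fromℕ n ^ c) ⁻¹))
  structureFor w′ with sampling (rankWeight ℛ 𝒰 𝒮 w′ c) (rankWeight-nonNeg ℛ 𝒰 𝒮 w′ c)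
  ... | D , D-size , samples = D , D-size , finds
    where
    w : X → ℝ
    w = rankWeight ℛ 𝒰 𝒮 w′ c

    Found : Range → X → Pred Ω 0ℓ
    Found q x ω = IsMaximum ℛ 𝒰 𝒮 w′ ⟦ q ⟧ x ×
                  answer ℛ 𝒰 𝒮 encode p D q (Q n) ω ≡ just (toℕ x)

    -- A run has a single output, and `toℕ` is injective.
    found-disjoint : ∀ q x y → x ≢ y → Found q x ⊥ Found q y
    found-disjoint q x y x≢y ((_ , ≡x) , (_ , ≡y)) =
      x≢y (toℕ-injective (just-injective (trans (sym ≡x) ≡y)))

    -- Being a maximum does not depend on `ω`. The event is therefore either that the answer is `x`,
    -- whose probability sampling prescribes, or empty; `maximumWeight` makes the same distinction.
    Pr-found : ∀ q → Nonempty ⟦ q ⟧ → ∀ x →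
      Pr[ Found q x ]≡ (maximumWeight ℛ 𝒰 𝒮 w′ w ⟦ q ⟧ x * weight ℛ 𝒰 𝒮 w ⟦ q ⟧ ⁻¹)
    Pr-found q q≢∅ x with maximum? ℛ 𝒰 𝒮 w′ ⟦ q ⟧ x
    ... | yes max = Pr-cong ((max ,_) , proj₂)
      (proj₂ (samples q (W-positive ℛ 𝒰 𝒮 w′ c ⟦ q ⟧ q≢∅)) x (proj₁ max))
    ... | no ¬max = subst (λ r → Pr[ Found q x ]≡ r) (sym (zeroˡ _))
      (Pr-cong ((λ ()) , λ (max , _) → contradiction max ¬max) Pr-∅)

    finds : ∀ q → Nonempty ⟦ q ⟧ →
      HaltsWithin ℛ 𝒰 𝒮 encode (Q n) p D q ×
      Pr[ ⋃ X (Found q) ]≥ (1# - (fromℕ n ^ c) ⁻¹)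
    finds q q≢∅
      -- The success event unfolds to the union of the events `Found q x`, so its probability is
      -- exactly the sum bounded by `success-bound`.
      with P-additive (Found q) _ (found-disjoint q) (Pr-found q q≢∅)
    ... | meas , P≡ = proj₁ (samples q (W-positive ℛ 𝒰 𝒮 w′ c ⟦ q ⟧ q≢∅)) ,
      meas , subst (_ ≤_) (sym P≡) (success-bound ℛ 𝒰 𝒮 w′ c ⟦ q ⟧ q≢∅)
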